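{- Let $0<\alpha<1$. Then every graph $G$ contains a cycle of length at least $$\frac{1-\alpha}{16000}\cdot c_{\alpha}(G).$$
   Context: All graphs are finite and simple. For a graph $H$, $|H|$ denotes its number of vertices, $e(H)$ its number of edges and $d(H)=2e(H)/|H|$ its average degree. For $\alpha\in(0,1)$, a subgraph $H\subseteq G$ is an $\alpha$-crux of $G$ if $d(H)\ge \alpha\cdot d(G)$, and the $\alpha$-crux function of $G$ is $$c_{\alpha}(G)=\min\{ |H| : H\subseteq G \text{ and } d(H)\ge \alpha\cdot d(G)\},$$ the order of a smallest $\alpha$-crux of $G$.
   Formalization: The claim fails for forests (a single edge has a positive bound but no cycle), so the formal version assumes the bound (1-α)c_α(G)/16000 is at least 3 (below 3 any cycle suffices); also α is taken rational, and G has at least one vertex. -}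

module Defs where

open import Data.Nat as ℕ using (ℕ; zero; suc; _<ᵇ_)
open import Data.Bool using (Bool; true; false; _∧_; if_then_else_)
open import Data.Fin using (Fin; toℕ; inject₁; fromℕ)
import Data.Fin as F
open import Data.List using (List; allFin; map; concatMap)
open import Data.Nat.ListAction using (sum)
open import Data.Integer using (+_)
open import Data.Rational using (ℚ; _/_; 0ℚ; _≤_; _*_)
open import Data.Product using (Σ; _×_; ∃)
open import Function.Definitions using (Injective)
open import Relation.Binary.PropositionalEquality using (_≡_)

record Graph : Set where
  field
    n   : ℕ
    adj : Fin n → Fin n → Bool
    sym : ∀ i j → adj i j ≡ adj j i
    irr : ∀ i → adj i i ≡ false
open Graph public

order : Graph → ℕ
order G = n G

edges : Graph → ℕ
edges G = sum (concatMap (λ i → map (λ j →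
            if (toℕ i <ᵇ toℕ j) ∧ adj G i j then 1 else 0) (allFin (n G)))
            (allFin (n G)))

-- d(G) = 2 e(G) / |G|  (only used for graphs with at least one vertex;
-- for the empty graph we set it to 0, a value that is never used below).
avgDeg : Graph → ℚ
avgDeg G with n G
... | zero  = 0ℚ
... | suc k = + (2 ℕ.* edges G) / suc k

record Subgraph (H G : Graph) : Set where
  field
    emb     : Fin (n H) → Fin (n G)
    emb-inj : Injective _≡_ _≡_ emb
    emb-adj : ∀ i j → adj H i j ≡ true → adj G (emb i) (emb j) ≡ true

IsCrux : ℚ → Graph → Graph → Set
IsCrux α G H = Subgraph H G × (1 ℕ.≤ n H) × (α * avgDeg G ≤ avgDeg H)

IsCruxNumber : ℚ → Graph → ℕ → Set
IsCruxNumber α G m =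
  (Σ Graph λ H → IsCrux α G H × n H ≡ m) ×
  (∀ H → IsCrux α G H → m ℕ.≤ n H)

record Cycle (G : Graph) (ℓ : ℕ) : Set where
  field
    len≥3 : 3 ℕ.≤ ℓ
    k     : ℕ
    ℓ≡    : ℓ ≡ suc k
    v     : Fin (suc k) → Fin (n G)
    v-inj : Injective _≡_ _≡_ v
    v-adj : ∀ (i : Fin k) → adj G (v (inject₁ i)) (v (F.suc i)) ≡ true
    v-cls : adj G (v (fromℕ k)) (v F.zero) ≡ true

{-# OPTIONS --safe #-}
module Submission where

-- Sets of vertices are duplicate-free lists.  Start from the whole vertex set and keep a set U whose
-- average degree is at least d(G).  A depth-first search of U (after Krivelevich) finds either a cycle
-- with more than t vertices or a set S of between h and 2h vertices with at most t neighbours T in U.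
-- For h about m/4 and t about (1 - α)h the set S ∪ T has fewer than m = c_α(G) vertices, so its average
-- degree is below α d(G), and removing S from U does not bring the average degree below d(G).  Since U
-- never has fewer than m vertices, some search ends with a cycle.

open import Defs
import Algebra.Solver.CommutativeMonoid as CMSolver
open import Data.Bool using (Bool; true; false; _∧_; if_then_else_)
open import Data.Empty using (⊥-elim)
open import Data.Fin using (Fin; toℕ; fromℕ; inject₁)
import Data.Fin as Fin
import Data.Fin.Properties as Fin
import Data.Integer as ℤ
import Data.Integer.Properties as ℤ
import Data.Integer.Tactic.RingSolver as ℤ
open import Data.List using (List; []; _∷_; [_]; _++_; length; map; take; drop; lookup; allFin; concatMap)
open import Data.List.Membership.Propositional using (_∈_)
open import Data.List.Membership.Propositional.Properties using (∈-++⁻; ∈-++⁺ˡ; ∈-++⁺ʳ; ∈-lookup)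
open import Data.List.Properties using (map-++; map-cong; map-tabulate; tabulate-lookup; length-++; length-take; length-tabulate; take++drop≡id; ++-assoc; ++-identityʳ)
open import Data.List.Relation.Binary.Permutation.Propositional using (_↭_; prep; swap; ↭-sym; ↭-trans; ↭-refl; ↭-reflexive; ↭⇒↭ₛ)
open import Data.List.Relation.Binary.Permutation.Propositional.Properties using (∈-resp-↭; map⁺; ++⁺ˡ; ↭-length; ++-commutativeMonoid)
import Data.List.Relation.Binary.Permutation.Setoid.Properties as Permₛ
import Data.List.Relation.Unary.All as All
import Data.List.Relation.Unary.All.Properties as All
open import Data.List.Relation.Unary.AllPairs using ([]; _∷_)
open import Data.List.Relation.Unary.Any using (here; there)
open import Data.List.Relation.Unary.Linked using (Linked; []; [-]; _∷_)
open import Data.List.Relation.Unary.Unique.Propositional using (Unique)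
open import Data.List.Relation.Unary.Unique.Propositional.Properties using (allFin⁺)
open import Data.Nat using (ℕ; zero; suc; _+_; _∸_; _*_; _≤_; _<_; _<ᵇ_; _<?_; z≤n; s≤s; NonZero; >-nonZero)
import Data.Nat.DivMod as ℕ
open import Data.Nat.ListAction using (sum)
open import Data.Nat.ListAction.Properties using (sum-++; sum-↭)
open import Data.Nat.Properties
open import Data.Nat.Tactic.RingSolver using (solve-∀)
open import Data.Product using (Σ; _×_; _,_; ∃; ∃₂)
open import Data.Rational using (ℚ; mkℚ; _/_; 0ℚ; 1ℚ; toℚᵘ)
import Data.Rational as ℚ
import Data.Rational.Properties as ℚ
open import Data.Rational.Unnormalised using (mkℚᵘ)
import Data.Rational.Unnormalised as ℚᵘ
import Data.Rational.Unnormalised.Properties as ℚᵘ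
open import Data.Sum using (_⊎_; inj₁; inj₂; [_,_]′)
open import Function using (_∘_; id)
open import Relation.Binary.PropositionalEquality as ≡ using (_≡_; refl; cong; cong₂; subst; subst₂; trans)
open import Relation.Binary.PropositionalEquality.Properties using (setoid)
open import Relation.Nullary using (yes; no)

private
  variable
    A B : Set

-- Lists

Unique-++⁻ˡ : ∀ (xs : List A) {ys} → Unique (xs ++ ys) → Unique xs
Unique-++⁻ˡ []       _        = []
Unique-++⁻ˡ (x ∷ xs) (p ∷ ps) = All.++⁻ˡ xs p ∷ Unique-++⁻ˡ xs ps

Unique-++⁻ʳ : ∀ (xs : List A) {ys} → Unique (xs ++ ys) → Unique ys
Unique-++⁻ʳ []       u        = u
Unique-++⁻ʳ (x ∷ xs) (_ ∷ ps) = Unique-++⁻ʳ xs ps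

Unique-resp-↭ : {xs ys : List A} → xs ↭ ys → Unique xs → Unique ys
Unique-resp-↭ p = Permₛ.Unique-resp-↭ (setoid _) (↭⇒↭ₛ p)

Unique⇒lookup-injective : ∀ {xs : List A} → Unique xs → ∀ {i j} → lookup xs i ≡ lookup xs j → i ≡ j
Unique⇒lookup-injective (_ ∷ _) {Fin.zero}  {Fin.zero}  _  = refl
Unique⇒lookup-injective (p ∷ _) {Fin.zero}  {Fin.suc j} eq = ⊥-elim (All.lookup p (∈-lookup j) eq)
Unique⇒lookup-injective (p ∷ _) {Fin.suc i} {Fin.zero}  eq = ⊥-elim (All.lookup p (∈-lookup i) (≡.sym eq))
Unique⇒lookup-injective (_ ∷ u) {Fin.suc i} {Fin.suc j} eq = cong Fin.suc (Unique⇒lookup-injective u eq)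

Linked-++⁻ˡ : ∀ {R : A → A → Set} xs {ys} → Linked R (xs ++ ys) → Linked R xs
Linked-++⁻ˡ []           _       = []
Linked-++⁻ˡ (x ∷ [])     _       = [-]
Linked-++⁻ˡ (x ∷ y ∷ xs) (r ∷ l) = r ∷ Linked-++⁻ˡ (y ∷ xs) l

lookup-Linked : ∀ {R : A → A → Set} {x xs} → Linked R (x ∷ xs) → (i : Fin (length xs)) →
                R (lookup (x ∷ xs) (inject₁ i)) (lookup (x ∷ xs) (Fin.suc i))
lookup-Linked (r ∷ _) Fin.zero    = r
lookup-Linked (_ ∷ l) (Fin.suc i) = lookup-Linked l i

lookup-last : ∀ (x : A) ys u → lookup (x ∷ ys ++ [ u ]) (fromℕ (length (ys ++ [ u ]))) ≡ u
lookup-last x []       u = refl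
lookup-last x (y ∷ ys) u = lookup-last y ys u

∈-drop⇒++ : ∀ t (xs : List A) {x} → x ∈ drop t xs → ∃₂ λ ys zs → xs ≡ ys ++ x ∷ zs × t ≤ length ys
∈-drop⇒++ zero    (x ∷ xs) (here refl) = [] , xs , refl , z≤n
∈-drop⇒++ zero    (x ∷ xs) (there p) with ∈-drop⇒++ zero xs p
... | ys , zs , eq , _ = x ∷ ys , zs , cong (x ∷_) eq , z≤n
∈-drop⇒++ (suc t) (x ∷ xs) p with ∈-drop⇒++ t xs p
... | ys , zs , eq , le = x ∷ ys , zs , cong (x ∷_) eq , s≤s le

∈-drop-∷ : ∀ t {x y : A} xs → y ∈ drop t xs → y ∈ drop t (x ∷ xs)
∈-drop-∷ zero    xs       p = there p
∈-drop-∷ (suc t) (_ ∷ xs) p = ∈-drop-∷ t xs p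

-- A hit is brought to the front by a permutation, because vertex sets matter only up to order.
find : (f : A → Bool) (xs : List A) →
       (∃₂ λ x ys → xs ↭ x ∷ ys × f x ≡ true) ⊎ (∀ {x} → x ∈ xs → f x ≡ false)
find f [] = inj₂ λ ()
find f (x ∷ xs) with f x in eq
... | true  = inj₁ (x , xs , ↭-refl , eq)
... | false with find f xs
...   | inj₁ (y , ys , p , fy) = inj₁ (y , x ∷ ys , ↭-trans (prep x p) (swap x y ↭-refl) , fy)
...   | inj₂ none = inj₂ λ { (here refl) → eq ; (there q) → none q }

-- Finite sums

∑ : List A → (A → ℕ) → ℕ
∑ xs f = sum (map f xs)

∑-cong : ∀ (xs : List A) {f g} → (∀ x → f x ≡ g x) → ∑ xs f ≡ ∑ xs g
∑-cong xs eq = cong sum (map-cong eq xs)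

∑-++ : ∀ (xs ys : List A) f → ∑ (xs ++ ys) f ≡ ∑ xs f + ∑ ys f
∑-++ xs ys f = trans (cong sum (map-++ f xs ys)) (sum-++ (map f xs) (map f ys))

∑-↭ : ∀ {xs ys : List A} f → xs ↭ ys → ∑ xs f ≡ ∑ ys f
∑-↭ f p = sum-↭ (map⁺ f p)

∑-+ : ∀ (xs : List A) f g → ∑ xs (λ x → f x + g x) ≡ ∑ xs f + ∑ xs g
∑-+ []       f g = refl
∑-+ (x ∷ xs) f g = trans (cong (f x + g x +_) (∑-+ xs f g)) (interchange (f x) (g x) (∑ xs f) (∑ xs g))
  where
  interchange : ∀ a b c d → a + b + (c + d) ≡ a + c + (b + d)
  interchange = solve-∀

∑-zero : ∀ (xs : List A) {f} → (∀ {x} → x ∈ xs → f x ≡ 0) → ∑ xs f ≡ 0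
∑-zero []       _  = refl
∑-zero (x ∷ xs) eq = cong₂ _+_ (eq (here refl)) (∑-zero xs (eq ∘ there))

∑-swap : ∀ (xs : List A) (ys : List B) (f : A → B → ℕ) →
         ∑ xs (λ x → ∑ ys (f x)) ≡ ∑ ys (λ y → ∑ xs (λ x → f x y))
∑-swap []       ys f = ≡.sym (∑-zero ys λ _ → refl)
∑-swap (x ∷ xs) ys f =
  trans (cong (∑ ys (f x) +_) (∑-swap xs ys f)) (≡.sym (∑-+ ys (f x) λ y → ∑ xs (λ x → f x y)))

∑-concatMap : ∀ (xs : List A) (g : A → List ℕ) → sum (concatMap g xs) ≡ ∑ xs (sum ∘ g)
∑-concatMap []       g = refl
∑-concatMap (x ∷ xs) g = trans (sum-++ (g x) (concatMap g xs)) (cong (sum (g x) +_) (∑-concatMap xs g))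

∑-lookup : ∀ (xs : List A) f → ∑ (allFin (length xs)) (f ∘ lookup xs) ≡ ∑ xs f
∑-lookup xs f = trans (cong sum (map-tabulate id (f ∘ lookup xs)))
  (cong sum (trans (≡.sym (map-tabulate (lookup xs) f)) (cong (map f) (tabulate-lookup xs))))

-- Edge counts

𝟙 : Bool → ℕ
𝟙 b = if b then 1 else 0

-- Ordered pairs are counted, so for duplicate-free X the value `arcs G X X` is twice the number of
-- edges inside X, that is, |X| times its average degree.
arcs : (G : Graph) → List (Fin (n G)) → List (Fin (n G)) → ℕ
arcs G xs ys = ∑ xs λ x → ∑ ys λ y → 𝟙 (adj G x y)

module _ (G : Graph) where

  arcs-++ˡ : ∀ xs ys zs → arcs G (xs ++ ys) zs ≡ arcs G xs zs + arcs G ys zs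
  arcs-++ˡ xs ys zs = ∑-++ xs ys _

  arcs-comm : ∀ xs ys → arcs G xs ys ≡ arcs G ys xs
  arcs-comm xs ys = trans (∑-swap xs ys _) (∑-cong ys λ y → ∑-cong xs λ x → cong 𝟙 (Graph.sym G x y))

  arcs-++ʳ : ∀ xs ys zs → arcs G xs (ys ++ zs) ≡ arcs G xs ys + arcs G xs zs
  arcs-++ʳ xs ys zs = trans (arcs-comm xs (ys ++ zs))
    (trans (arcs-++ˡ ys zs xs) (cong₂ _+_ (arcs-comm ys xs) (arcs-comm zs xs)))

  arcs-↭ : ∀ {xs ys} → xs ↭ ys → arcs G xs xs ≡ arcs G ys ys
  arcs-↭ {xs} {ys} p = trans (∑-cong xs λ _ → ∑-↭ _ p) (∑-↭ _ p)

  arcs-square : ∀ xs ys → arcs G (xs ++ ys) (xs ++ ys) ≡ arcs G xs xs + 2 * arcs G xs ys + arcs G ys ys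
  arcs-square xs ys = begin
    arcs G (xs ++ ys) (xs ++ ys)
      ≡⟨ arcs-++ˡ xs ys (xs ++ ys) ⟩
    arcs G xs (xs ++ ys) + arcs G ys (xs ++ ys)
      ≡⟨ cong₂ _+_ (arcs-++ʳ xs xs ys) (trans (arcs-++ʳ ys xs ys) (cong (_+ arcs G ys ys) (arcs-comm ys xs))) ⟩
    arcs G xs xs + arcs G xs ys + (arcs G xs ys + arcs G ys ys)
      ≡⟨ regroup (arcs G xs xs) (arcs G xs ys) (arcs G ys ys) ⟩
    arcs G xs xs + 2 * arcs G xs ys + arcs G ys ys ∎
    where
    open ≡.≡-Reasoning
    regroup : ∀ a b c → a + b + (b + c) ≡ a + 2 * b + c
    regroup = solve-∀

  -- Each edge {i, j} is counted by edges once, at the arc with i < j.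
  2*edges≡arcs : 2 * edges G ≡ arcs G (allFin (n G)) (allFin (n G))
  2*edges≡arcs = begin
    2 * edges G
      ≡⟨ cong (2 *_) (∑-concatMap V _) ⟩
    2 * ∑ V (λ i → ∑ V (up i))
      ≡⟨ cong (∑ V (λ i → ∑ V (up i)) +_) (+-identityʳ _) ⟩
    ∑ V (λ i → ∑ V (up i)) + ∑ V (λ i → ∑ V (up i))
      ≡⟨ cong (∑ V (λ i → ∑ V (up i)) +_) (∑-swap V V up) ⟩
    ∑ V (λ i → ∑ V (up i)) + ∑ V (λ i → ∑ V (λ j → up j i))
      ≡⟨ ∑-+ V _ _ ⟨
    ∑ V (λ i → ∑ V (up i) + ∑ V (λ j → up j i))
      ≡⟨ ∑-cong V (λ i → ≡.sym (∑-+ V (up i) λ j → up j i)) ⟩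
    ∑ V (λ i → ∑ V (λ j → up i j + up j i))
      ≡⟨ ∑-cong V (λ i → ∑-cong V (orient i)) ⟩
    arcs G V V ∎
    where
    open ≡.≡-Reasoning
    V = allFin (n G)
    up : Fin (n G) → Fin (n G) → ℕ
    up i j = 𝟙 ((toℕ i <ᵇ toℕ j) ∧ adj G i j)
    orientᵇ : ∀ a b x → (a ≡ b → x ≡ false) → 𝟙 ((a <ᵇ b) ∧ x) + 𝟙 ((b <ᵇ a) ∧ x) ≡ 𝟙 x
    orientᵇ zero    zero    x h rewrite h refl = refl
    orientᵇ zero    (suc b) x h = +-identityʳ _
    orientᵇ (suc a) zero    x h = refl
    orientᵇ (suc a) (suc b) x h = orientᵇ a b x (h ∘ cong suc)
    loopless : ∀ i j → toℕ i ≡ toℕ j → adj G i j ≡ false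
    loopless i j eq = trans (cong (adj G i) (≡.sym (Fin.toℕ-injective eq))) (irr G i)
    orient : ∀ i j → up i j + up j i ≡ 𝟙 (adj G i j)
    orient i j = trans
      (cong (λ b → up i j + 𝟙 ((toℕ j <ᵇ toℕ i) ∧ b)) (Graph.sym G j i))
      (orientᵇ (toℕ i) (toℕ j) (adj G i j) (loopless i j))

-- Induced subgraphs

module _ (G : Graph) where

  induced : List (Fin (n G)) → Graph
  induced xs = record
    { n   = length xs
    ; adj = λ i j → adj G (lookup xs i) (lookup xs j)
    ; sym = λ i j → Graph.sym G (lookup xs i) (lookup xs j)
    ; irr = λ i → irr G (lookup xs i)
    }

  induced-subgraph : ∀ {xs} → Unique xs → Subgraph (induced xs) G
  induced-subgraph {xs} xs! = record
    { emb     = lookup xs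
    ; emb-inj = Unique⇒lookup-injective xs!
    ; emb-adj = λ _ _ a → a
    }

  2*edges-induced : ∀ xs → 2 * edges (induced xs) ≡ arcs G xs xs
  2*edges-induced xs = trans (2*edges≡arcs (induced xs))
    (trans (∑-cong (allFin (length xs)) λ i → ∑-lookup xs (λ y → 𝟙 (adj G (lookup xs i) y)))
           (∑-lookup xs λ x → ∑ xs λ y → 𝟙 (adj G x y)))

-- Sets without edges between them, and cycles closed by a chord of a path

module _ (G : Graph) where

  private
    V = Fin (n G)

  Adj : V → V → Set
  Adj x y = adj G x y ≡ true

  NoEdge : List V → List V → Set
  NoEdge xs ys = ∀ {x y} → x ∈ xs → y ∈ ys → adj G x y ≡ false

  NoEdge-++ˡ : ∀ xs {ys zs} → NoEdge xs zs → NoEdge ys zs → NoEdge (xs ++ ys) zs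
  NoEdge-++ˡ xs p q x∈ z∈ = [ (λ i → p i z∈) , (λ i → q i z∈) ]′ (∈-++⁻ xs x∈)

  NoEdge-++ʳ : ∀ ys {xs zs} → NoEdge xs ys → NoEdge xs zs → NoEdge xs (ys ++ zs)
  NoEdge-++ʳ ys p q x∈ y∈ = [ p x∈ , q x∈ ]′ (∈-++⁻ ys y∈)

  NoEdge-∷ : ∀ {x xs ys} → (∀ {y} → y ∈ ys → adj G x y ≡ false) → NoEdge xs ys → NoEdge (x ∷ xs) ys
  NoEdge-∷ p q (here refl) = p
  NoEdge-∷ p q (there x∈)  = q x∈

  NoEdge⇒arcs≡0 : ∀ {xs ys} → NoEdge xs ys → arcs G xs ys ≡ 0
  NoEdge⇒arcs≡0 {xs} {ys} p = ∑-zero xs λ x∈ → ∑-zero ys λ y∈ → cong 𝟙 (p x∈ y∈)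

  -- An edge leaving S ends in T, so the arcs lost by deleting S all lie inside S ∪ T.
  arcs-delete : ∀ {U} S T R → U ↭ S ++ T ++ R → NoEdge S R →
                arcs G U U ≤ arcs G (S ++ T) (S ++ T) + arcs G (T ++ R) (T ++ R)
  arcs-delete {U} S T R U↭ S-R = begin
    arcs G U U
      ≡⟨ trans (arcs-↭ G U↭) (arcs-square G S (T ++ R)) ⟩
    arcs G S S + 2 * arcs G S (T ++ R) + arcs G (T ++ R) (T ++ R)
      ≡⟨ cong (λ k → arcs G S S + 2 * k + arcs G (T ++ R) (T ++ R)) S-TR ⟩
    arcs G S S + 2 * arcs G S T + arcs G (T ++ R) (T ++ R)
      -- Adding `arcs G T T` completes the square for `S ++ T`.
      ≤⟨ +-monoˡ-≤ (arcs G (T ++ R) (T ++ R)) (m≤m+n (arcs G S S + 2 * arcs G S T) (arcs G T T)) ⟩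
    arcs G S S + 2 * arcs G S T + arcs G T T + arcs G (T ++ R) (T ++ R)
      ≡⟨ cong (_+ arcs G (T ++ R) (T ++ R)) (arcs-square G S T) ⟨
    arcs G (S ++ T) (S ++ T) + arcs G (T ++ R) (T ++ R) ∎
    where
    open ≤-Reasoning
    S-TR : arcs G S (T ++ R) ≡ arcs G S T
    S-TR = trans (arcs-++ʳ G S T R)
      (trans (cong (arcs G S T +_) (NoEdge⇒arcs≡0 S-R)) (+-identityʳ _))

  path⇒cycle : ∀ w ys u → Linked Adj (w ∷ ys ++ [ u ]) → Unique (w ∷ ys ++ [ u ]) → Adj w u →
               1 ≤ length ys → Cycle G (2 + length ys)
  path⇒cycle w ys u path path! w~u 1≤ = record
    { len≥3 = s≤s (s≤s 1≤)
    ; k     = length (ys ++ [ u ])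
    ; ℓ≡    = cong suc (trans (+-comm 1 (length ys)) (≡.sym (length-++ ys)))
    ; v     = lookup (w ∷ ys ++ [ u ])
    ; v-inj = Unique⇒lookup-injective path!
    ; v-adj = lookup-Linked path
    ; v-cls = trans (cong (λ x → adj G x w) (lookup-last w ys u)) (trans (Graph.sym G u w) w~u)
    }

  LongCycle : ℕ → Set
  LongCycle t = Σ ℕ λ ℓ → Cycle G ℓ × 2 + t ≤ ℓ

  -- At least t path vertices lie between w and u, so the segment from w to u together with the edge
  -- joining them is a cycle on at least 2 + t vertices; t ≥ 1 makes this at least 3.
  far-neighbour⇒LongCycle : ∀ {t w P u} → 1 ≤ t → Linked Adj (w ∷ P) → Unique (w ∷ P) →
                            u ∈ drop t P → Adj w u → LongCycle t
  far-neighbour⇒LongCycle {t} {w} {P} {u} 1≤t path path! u∈ w~u with ∈-drop⇒++ t P u∈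
  ... | ys , zs , refl , t≤ = 2 + length ys ,
      path⇒cycle w ys u (Linked-++⁻ˡ (w ∷ ys ++ [ u ]) (subst (Linked Adj) eq path))
        (Unique-++⁻ˡ (w ∷ ys ++ [ u ]) (subst Unique eq path!)) w~u (≤-trans 1≤t t≤) ,
      s≤s (s≤s t≤)
    where
    eq : w ∷ ys ++ u ∷ zs ≡ (w ∷ ys ++ [ u ]) ++ zs
    eq = cong (w ∷_) (≡.sym (++-assoc ys [ u ] zs))

  -- Depth-first search

  -- S is the set to delete, T contains all neighbours of S in U outside S, and R is the rest. For
  -- duplicate-free U, `U↭` makes the three disjoint.
  record Separation (U : List V) (h t : ℕ) : Set where
    field
      S T R : List V
      U↭    : U ↭ S ++ T ++ R
      h≤S   : h ≤ length S
      S<2h  : length S < h + h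
      T≤t   : length T ≤ t
      S-R   : NoEdge S R

  -- P is the current stack, top first; F consists of the vertices that have been finished since the
  -- top of P was pushed, O of those finished before, and A is unvisited.
  record State (U : List V) (t : ℕ) (P O F A : List V) : Set where
    field
      U↭    : U ↭ F ++ P ++ O ++ A
      F-A   : NoEdge F A
      O-A   : NoEdge O A
      F-O   : NoEdge F O
      F-far : NoEdge F (drop t P)

  -- An empty stack admits every vertex as a new root.
  extends : List V → V → Bool
  extends []      w = true
  extends (p ∷ P) w = adj G p w

  extends⇒Linked : ∀ {w} P → extends P w ≡ true → Linked Adj P → Linked Adj (w ∷ P)
  extends⇒Linked     []      _   _    = [-]
  extends⇒Linked {w} (p ∷ P) p~w path = trans (Graph.sym G w p) p~w ∷ path

  module _ {U : List V} {t : ℕ} where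

    open State

    -- The vertices of F were finished before w enters the stack, so they join O. The new F is
    -- empty, and the conditions on it hold vacuously.
    push : ∀ {P O F A w A₁} → State U t P O F A → A ↭ w ∷ A₁ → State U t (w ∷ P) (O ++ F) [] A₁
    push {P} {O} {F} {A} {w} {A₁} s A↭ = record
      { U↭    = ↭-trans (U↭ s) (↭-trans (++⁺ˡ F (++⁺ˡ P (++⁺ˡ O A↭))) rearrange)
      ; F-A   = λ ()
      ; O-A   = NoEdge-++ˡ O (λ x∈ y∈ → O-A s x∈ (∈-resp-↭ (↭-sym A↭) (there y∈)))
                             (λ x∈ y∈ → F-A s x∈ (∈-resp-↭ (↭-sym A↭) (there y∈)))
      ; F-O   = λ ()
      ; F-far = λ ()
      }
      where
      open CMSolver (++-commutativeMonoid {A = V})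
      rearrange : F ++ P ++ O ++ w ∷ A₁ ↭ w ∷ P ++ (O ++ F) ++ A₁
      rearrange = solve 5 (λ f p o w a → f ⊕ (p ⊕ (o ⊕ (w ⊕ a))) ⊜ (w ⊕ p) ⊕ ((o ⊕ f) ⊕ a)) ↭-refl F P O [ w ] A₁

    -- Here s is the state before w was pushed and s′ the state once the search above w is
    -- exhausted. There is no edge from w to O because w was still unvisited in s, and none from w
    -- to A′ by exhaustion. The old F, stored inside the older part of s′, returns to join w and F′.
    pop : ∀ {P O F A w F′ A′} → State U t P O F A → w ∈ A → (∀ {u} → u ∈ drop t P → adj G w u ≡ false) →
          State U t (w ∷ P) (O ++ F) F′ A′ → (∀ {x} → x ∈ A′ → adj G w x ≡ false) →
          State U t P O (w ∷ F′ ++ F) A′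
    pop {P} {O} {F} {A} {w} {F′} {A′} s w∈ w-far s′ w-A′ = record
      { U↭    = ↭-trans (U↭ s′) rearrange
      ; F-A   = NoEdge-∷ w-A′ (NoEdge-++ˡ F′ (F-A s′) (λ x∈ → O-A s′ (∈-++⁺ʳ O x∈)))
      ; O-A   = λ x∈ → O-A s′ (∈-++⁺ˡ x∈)
      ; F-O   = NoEdge-∷ (λ {y} y∈ → trans (Graph.sym G w y) (O-A s y∈ w∈))
                  (NoEdge-++ˡ F′ (λ x∈ y∈ → F-O s′ x∈ (∈-++⁺ˡ y∈)) (F-O s))
      ; F-far = NoEdge-∷ w-far (NoEdge-++ˡ F′ (λ x∈ y∈ → F-far s′ x∈ (∈-drop-∷ t P y∈)) (F-far s))
      }
      where
      open CMSolver (++-commutativeMonoid {A = V})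
      rearrange : F′ ++ (w ∷ P) ++ (O ++ F) ++ A′ ↭ (w ∷ F′ ++ F) ++ P ++ O ++ A′
      rearrange = solve 6 (λ f′ w p o f a → f′ ⊕ ((w ⊕ p) ⊕ ((o ⊕ f) ⊕ a)) ⊜ (w ⊕ (f′ ⊕ f)) ⊕ (p ⊕ (o ⊕ a)))
                    ↭-refl F′ [ w ] P O F A′

    state⇒separation : ∀ {h P O F A} → State U t P O F A → h ≤ length F → length F < h + h → Separation U h t
    state⇒separation {h} {P} {O} {F} {A} s h≤F F<2h = record
      { S    = F
      ; T    = take t P
      ; R    = drop t P ++ O ++ A
      ; U↭   = ↭-trans (U↭ s) (++⁺ˡ F (↭-reflexive (trans (cong (_++ O ++ A) (≡.sym (take++drop≡id t P)))
                 (++-assoc (take t P) (drop t P) (O ++ A)))))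
      ; h≤S  = h≤F
      ; S<2h = F<2h
      ; T≤t  = subst (_≤ t) (≡.sym (length-take t P)) (m⊓n≤m t (length P))
      ; S-R  = NoEdge-++ʳ (drop t P) (F-far s) (NoEdge-++ʳ O (F-O s) (F-A s))
      }

  module _ {U : List V} (U! : Unique U) {h t : ℕ} (1≤h : 1 ≤ h) (1≤t : 1 ≤ t) where

    -- The search above P stopped with fewer than h finished vertices and no unvisited vertex that
    -- could be pushed on P. The bound on A′ keeps the fuel sufficient when the search resumes lower
    -- in the stack.
    Exhausted : (P O A : List V) → Set
    Exhausted P O A = ∃₂ λ F′ A′ →
      State U t P O F′ A′ × length F′ < h × length A′ ≤ length A × (∀ {x} → x ∈ A′ → extends P x ≡ false)

    -- Pushing w aborts with a long cycle if w has a neighbour more than t below it in the stack.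
    -- Hence a vertex finished above P sees at most the top t vertices of P, and its neighbours
    -- elsewhere are finished above P too: once F has h vertices it is separated by take t P.
    search : ∀ fuel P O F A → length A ≤ fuel → Linked Adj P → State U t P O F A → length F < h →
             (LongCycle t ⊎ Separation U h t) ⊎ Exhausted P O A
    search zero       P O F [] _ path s F<h = inj₂ (F , [] , s , F<h , z≤n , λ ())
    search (suc fuel) P O F A  A≤ path s F<h with find (extends P) A
    ... | inj₂ none = inj₂ (F , A , s , F<h , ≤-refl , none)
    ... | inj₁ (w , A₁ , A↭ , P~w) with find (adj G w) (drop t P)
    ...   | inj₁ (u , _ , far↭ , w~u) = inj₁ (inj₁ (far-neighbour⇒LongCycle 1≤t
            (extends⇒Linked P P~w path)
            (Unique-++⁻ˡ (w ∷ P) (Unique-resp-↭ (State.U↭ (push s A↭)) U!))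
            (∈-resp-↭ (↭-sym far↭) (here refl)) w~u))
    ...   | inj₂ w-far
      with A₁<A ← subst (length A₁ <_) (≡.sym (↭-length A↭)) ≤-refl
      with search fuel (w ∷ P) (O ++ F) [] A₁ (≤-pred (≤-trans A₁<A A≤)) (extends⇒Linked P P~w path) (push s A↭) 1≤h
    ...     | inj₁ done = inj₁ done
    ...     | inj₂ (F′ , A′ , s′ , F′<h , A′≤ , w-A′)
      with s″ ← pop s (∈-resp-↭ (↭-sym A↭) (here refl)) w-far s′ w-A′
      -- Both F′ and F have fewer than h vertices, so the merged set has fewer than 2h even when it
      -- first reaches h.
      with length (w ∷ F′ ++ F) <? h
    ...       | no  F″≮h = inj₁ (inj₂ (state⇒separation s″ (≮⇒≥ F″≮h)
                  (subst (_< h + h) (cong suc (≡.sym (length-++ F′))) (+-mono-≤-< F′<h F<h))))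
    ...       | yes F″<h
      with A′<A ← ≤-trans (s≤s A′≤) A₁<A
      with search fuel P O (w ∷ F′ ++ F) A′ (≤-pred (≤-trans A′<A A≤)) path s″ F″<h
    ...         | inj₁ done = inj₁ done
    ...         | inj₂ (F‴ , A‴ , s‴ , F‴<h , A‴≤ , none) =
                  inj₂ (F‴ , A‴ , s‴ , F‴<h , ≤-trans A‴≤ (<⇒≤ A′<A) , none)

    -- Exhaustion is impossible from the empty stack: every unvisited vertex could be a new root, so
    -- none is left, and F would be all of U although it has fewer than h vertices.
    longCycle-or-separation : h ≤ length U → LongCycle t ⊎ Separation U h t
    longCycle-or-separation h≤U with search (length U) [] [] [] U ≤-refl [] start 1≤h
      where
      start : State U t [] [] [] U
      start = record { U↭ = ↭-refl ; F-A = λ () ; O-A = λ () ; F-O = λ () ; F-far = λ () }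
    ... | inj₁ done = done
    ... | inj₂ (F , [] , s , F<h , _) = ⊥-elim (<⇒≱ F<h (subst (h ≤_) (trans (↭-length (State.U↭ s)) (cong length (++-identityʳ F))) h≤U))
    ... | inj₂ (F , x ∷ A , _ , _ , _ , none) with () ← none (here refl)

  -- Repeated deletion of sparse sets

  module _ {m h t p r N D : ℕ} (1≤h : 1 ≤ h) (1≤t : 1 ≤ t) (2h+t≤m : h + h + t ≤ m) (pt≤rh : p * t ≤ r * h)
    -- With α = p / (p + r) and d(G) = D / N, this says that nonempty sets of fewer than m vertices
    -- have average degree below α d(G), with denominators cleared.
    (sparse : ∀ {X} → Unique X → 1 ≤ length X → length X < m →
              (p + r) * (N * arcs G X X) < p * (D * length X))
    where

    -- A smaller U would have average degree below α d(G), which is at most d(G).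
    dense⇒m≤length : ∀ {U} → Unique U → 1 ≤ length U → D * length U ≤ N * arcs G U U → m ≤ length U
    dense⇒m≤length {U} U! 1≤U dense = ≮⇒≥ λ U<m → <-irrefl refl (begin-strict
      (p + r) * (N * arcs G U U) <⟨ sparse U! 1≤U U<m ⟩
      p * (D * length U)         ≤⟨ *-mono-≤ (m≤m+n p r) dense ⟩
      (p + r) * (N * arcs G U U) ∎)
      where open ≤-Reasoning

    -- S ∪ T is too sparse to account for the average degree that S would need.
    delete-separated : ∀ {U} → Unique U → D * length U ≤ N * arcs G U U → (s : Separation U h t) →
      let open Separation s in D * length (T ++ R) < N * arcs G (T ++ R) (T ++ R)
    delete-separated {U} U! dense s = *-cancelˡ-< (p + r) _ _ (+-cancelˡ-< ((p + r) * (D * length S)) _ _ (begin-strict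
      (p + r) * (D * length S) + (p + r) * (D * length Y)
        ≡⟨ regroup (p + r) D (length S) (length Y) ⟩
      (p + r) * (D * (length S + length Y))
        ≡⟨ cong (λ k → (p + r) * (D * k)) (trans (↭-length U↭) (length-++ S)) ⟨
      (p + r) * (D * length U)
        ≤⟨ *-monoʳ-≤ (p + r) (≤-trans dense (*-monoʳ-≤ N (arcs-delete S T R U↭ S-R))) ⟩
      (p + r) * (N * (arcs G X X + arcs G Y Y))
        ≡⟨ regroup (p + r) N (arcs G X X) (arcs G Y Y) ⟨
      (p + r) * (N * arcs G X X) + (p + r) * (N * arcs G Y Y)
        <⟨ +-monoˡ-< _ (sparse X! 1≤X X<m) ⟩
      p * (D * length X) + (p + r) * (N * arcs G Y Y)
        ≤⟨ +-monoˡ-≤ _ X≤S ⟩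
      (p + r) * (D * length S) + (p + r) * (N * arcs G Y Y) ∎))
      where
      open ≤-Reasoning
      open Separation s
      X = S ++ T
      Y = T ++ R
      regroup : ∀ a b c d → a * (b * c) + a * (b * d) ≡ a * (b * (c + d))
      regroup = solve-∀
      |X| : length X ≡ length S + length T
      |X| = length-++ S
      X! : Unique X
      X! = Unique-++⁻ˡ X (subst Unique (≡.sym (++-assoc S T R)) (Unique-resp-↭ U↭ U!))
      1≤X : 1 ≤ length X
      1≤X = subst (1 ≤_) (≡.sym |X|) (≤-trans (≤-trans 1≤h h≤S) (m≤m+n _ _))
      X<m : length X < m
      X<m = subst (_< m) (≡.sym |X|) (<-≤-trans (+-mono-<-≤ S<2h T≤t) 2h+t≤m)
      expand₁ : ∀ p d s t → p * (d * (s + t)) ≡ d * (p * s + p * t)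
      expand₁ = solve-∀
      expand₂ : ∀ p r d s → d * (p * s + r * s) ≡ (p + r) * (d * s)
      expand₂ = solve-∀
      -- This is α |S ∪ T| ≤ |S|, from p |T| ≤ p t ≤ r h ≤ r |S|.
      X≤S : p * (D * length X) ≤ (p + r) * (D * length S)
      X≤S = begin
        p * (D * length X)                      ≡⟨ cong (λ k → p * (D * k)) |X| ⟩
        p * (D * (length S + length T))         ≡⟨ expand₁ p D (length S) (length T) ⟩
        D * (p * length S + p * length T)
          ≤⟨ *-monoʳ-≤ D (+-monoʳ-≤ (p * length S)
               (≤-trans (*-monoʳ-≤ p T≤t) (≤-trans pt≤rh (*-monoʳ-≤ r h≤S)))) ⟩
        D * (p * length S + r * length S)       ≡⟨ expand₂ p r D (length S) ⟩
        (p + r) * (D * length S) ∎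

    -- Each deletion keeps U dense and removes at least h ≥ 1 vertices, so fuel bounding |U|
    -- suffices. A dense U has at least m ≥ h vertices, so the next search can always start.
    dense⇒LongCycle : ∀ fuel U → length U ≤ fuel → Unique U → 1 ≤ length U →
                      D * length U ≤ N * arcs G U U → LongCycle t
    dense⇒LongCycle zero       U U≤ U! 1≤U dense = ⊥-elim (<⇒≱ 1≤U U≤)
    dense⇒LongCycle (suc fuel) U U≤ U! 1≤U dense
      with longCycle-or-separation U! {h} 1≤h 1≤t
             (≤-trans (≤-trans (m≤m+n h h) (≤-trans (m≤m+n (h + h) t) 2h+t≤m)) (dense⇒m≤length U! 1≤U dense))
    ... | inj₁ cycle = cycle
    ... | inj₂ s = dense⇒LongCycle fuel (T ++ R) Y≤ (Unique-++⁻ʳ S (Unique-resp-↭ U↭ U!)) (nonempty (T ++ R) Y-dense) (<⇒≤ Y-dense)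
      where
      open Separation s
      Y-dense : D * length (T ++ R) < N * arcs G (T ++ R) (T ++ R)
      Y-dense = delete-separated U! dense s
      -- The strict inequality excludes the empty set, which has no arcs.
      nonempty : ∀ Y → D * length Y < N * arcs G Y Y → 1 ≤ length Y
      nonempty []      lt = ⊥-elim (<⇒≱ (subst (D * 0 <_) (*-zeroʳ N) lt) z≤n)
      nonempty (_ ∷ _) _  = s≤s z≤n
      Y≤ : length (T ++ R) ≤ fuel
      Y≤ = ≤-pred (begin
        1 + length (T ++ R)        ≤⟨ +-monoˡ-≤ _ (≤-trans 1≤h h≤S) ⟩
        length S + length (T ++ R) ≡⟨ trans (↭-length U↭) (length-++ S) ⟨
        length U                   ≤⟨ U≤ ⟩
        suc fuel                   ∎)
        where open ≤-Reasoning

-- Fractions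

open import Data.Integer using (+_; -[1+_])

infix 4 _≈_/suc_
-- The fraction need not be in lowest terms. Inequalities in ℚ thus become inequalities between
-- products of natural numbers.
_≈_/suc_ : ℚ → ℕ → ℕ → Set
x ≈ a /suc b = toℚᵘ x ℚᵘ.≃ mkℚᵘ (+ a) b

/-≈ : ∀ a b → + a / suc b ≈ a /suc b
/-≈ a b = ℚ.toℚᵘ-fromℚᵘ (mkℚᵘ (+ a) b)

-- The denominator `suc (d + b * suc d)` is `suc b * suc d` by computation.
*-≈ : ∀ {x y a b c d} → x ≈ a /suc b → y ≈ c /suc d → x ℚ.* y ≈ a * c /suc (d + b * suc d)
*-≈ {x} {y} {a} {b} {c} {d} x≈ y≈ = ℚᵘ.≃-trans (ℚ.toℚᵘ-homo-* x y)
  (ℚᵘ.≃-trans (ℚᵘ.*-cong x≈ y≈) (ℚᵘ.≃-reflexive (cong (λ k → mkℚᵘ k (d + b * suc d)) (≡.sym (ℤ.pos-* a c)))))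

≤-≈⁺ : ∀ {x y a b c d} → x ≈ a /suc b → y ≈ c /suc d → a * suc d ≤ c * suc b → x ℚ.≤ y
≤-≈⁺ {a = a} {b} {c} {d} x≈ y≈ le = ℚ.toℚᵘ-cancel-≤ (ℚᵘ.≤-respˡ-≃ (ℚᵘ.≃-sym x≈) (ℚᵘ.≤-respʳ-≃ (ℚᵘ.≃-sym y≈)
  (ℚᵘ.*≤* (subst₂ ℤ._≤_ (ℤ.pos-* a (suc d)) (ℤ.pos-* c (suc b)) (ℤ.+≤+ le)))))

≤-≈⁻ : ∀ {x y a b c d} → x ≈ a /suc b → y ≈ c /suc d → x ℚ.≤ y → a * suc d ≤ c * suc b
≤-≈⁻ {a = a} {b} {c} {d} x≈ y≈ le with ℚᵘ.≤-respˡ-≃ x≈ (ℚᵘ.≤-respʳ-≃ y≈ (ℚ.toℚᵘ-mono-≤ le))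
... | ℚᵘ.*≤* le′ = ℤ.drop‿+≤+ (subst₂ ℤ._≤_ (≡.sym (ℤ.pos-* a (suc d))) (≡.sym (ℤ.pos-* c (suc b))) le′)

1-≈ : ∀ {x p r b} → x ≈ p /suc b → p + r ≡ suc b → 1ℚ ℚ.- x ≈ r /suc b
1-≈ {x} {p} {r} {b} x≈ eq = ℚᵘ.≃-trans (ℚ.toℚᵘ-homo-+ 1ℚ (ℚ.- x))
  (ℚᵘ.≃-trans (ℚᵘ.+-congʳ ℚᵘ.1ℚᵘ (ℚᵘ.≃-trans (ℚ.toℚᵘ-homo‿- x) (ℚᵘ.-‿cong x≈))) (ℚᵘ.*≡* cross))
  where
  identity : ∀ p r → (ℤ.1ℤ ℤ.* (p ℤ.+ r) ℤ.+ ℤ.- p ℤ.* ℤ.1ℤ) ℤ.* (p ℤ.+ r) ≡ r ℤ.* (p ℤ.+ r)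
  identity = ℤ.solve-∀
  cross : (ℤ.1ℤ ℤ.* + suc b ℤ.+ ℤ.- (+ p) ℤ.* ℤ.1ℤ) ℤ.* + suc b ≡ + r ℤ.* + suc (b + 0)
  cross = trans (subst (λ q → (ℤ.1ℤ ℤ.* + q ℤ.+ ℤ.- (+ p) ℤ.* ℤ.1ℤ) ℤ.* + q ≡ + r ℤ.* + q) eq (identity (+ p) (+ r)))
                (cong (λ k → + r ℤ.* + suc k) (≡.sym (+-identityʳ b)))

avgDeg-≈ : ∀ (G : Graph) {k} → n G ≡ suc k → avgDeg G ≈ 2 * edges G /suc k
avgDeg-≈ G@record { n = suc k } refl = /-≈ (2 * edges G) k

-- Splitting the denominator as p + r gives 1 - α = r / (p + r), which avoids subtraction in the
-- later estimates.
unit-interval-≈ : ∀ α → 0ℚ ℚ.< α → α ℚ.< 1ℚ → ∃ λ p → ∃₂ λ r b → α ≈ p /suc b × p + r ≡ suc b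
unit-interval-≈ (mkℚ (+ p) b _) _ (ℚ.*<* p<q) =
  p , suc b ∸ p , b , ℚᵘ.≃-refl ,
  m+[n∸m]≡n (<⇒≤ (ℤ.drop‿+<+ (subst₂ ℤ._<_ (ℤ.*-identityʳ (+ p)) (ℤ.*-identityˡ (+ suc b)) p<q)))
unit-interval-≈ (mkℚ -[1+ _ ] _ _) (ℚ.*<* ()) _

-- The parameters of the search

-- h is about m / 4 and t about (1 - α) h, where α = p / (p + r).
choose-h-t : ∀ p r m K → 1 ≤ p + r → 4 ≤ K → 3 * ((p + r) * K) ≤ r * m →
  ∃₂ λ h t → 1 ≤ h × 1 ≤ t × h + h + t ≤ m × p * t ≤ r * h × r * m ≤ (2 + t) * ((p + r) * K)
choose-h-t p r m K 1≤q 4≤K large = h , t , ≤-trans 1≤t t≤h , 1≤t , 2h+t≤m , pt≤rh , rm≤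
  where
  open ≤-Reasoning
  instance
    q≢0 : NonZero (p + r)
    q≢0 = >-nonZero 1≤q
    K≢0 : NonZero K
    K≢0 = >-nonZero (≤-trans (s≤s z≤n) 4≤K)
    qK≢0 : NonZero ((p + r) * K)
    qK≢0 = m*n≢0 (p + r) K
  h = m ℕ./ 4
  t = (r * h) ℕ./ (p + r)
  4h≤m : h * 4 ≤ m
  4h≤m = ℕ.m/n*n≤m m 4
  tq≤rh : t * (p + r) ≤ r * h
  tq≤rh = ℕ.m/n*n≤m (r * h) (p + r)
  pt≤rh : p * t ≤ r * h
  pt≤rh = ≤-trans (≤-trans (*-monoˡ-≤ t (m≤m+n p r)) (≤-reflexive (*-comm (p + r) t))) tq≤rh
  t≤h : t ≤ h
  t≤h = *-cancelʳ-≤ t h (p + r) (≤-trans tq≤rh (≤-trans (*-monoˡ-≤ h (m≤n+m r p)) (≤-reflexive (*-comm (p + r) h))))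
  four : ∀ h → h * 4 ≡ h + h + h + h
  four = solve-∀
  2h+t≤m : h + h + t ≤ m
  2h+t≤m = begin
    h + h + t     ≤⟨ +-monoʳ-≤ (h + h) t≤h ⟩
    h + h + h     ≤⟨ m≤m+n _ h ⟩
    h + h + h + h ≡⟨ four h ⟨
    h * 4         ≤⟨ 4h≤m ⟩
    m             ∎
  m≤ : m ≤ 4 + h * 4
  m≤ = ≤-trans (≤-reflexive (ℕ.m≡m%n+[m/n]*n m 4)) (+-monoˡ-≤ (h * 4) (<⇒≤ (ℕ.m%n<n m 4)))
  rh≤ : r * h ≤ (p + r) + t * (p + r)
  rh≤ = ≤-trans (≤-reflexive (ℕ.m≡m%n+[m/n]*n (r * h) (p + r))) (+-monoˡ-≤ (t * (p + r)) (<⇒≤ (ℕ.m%n<n (r * h) (p + r))))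
  expand₁ : ∀ r h → r * (4 + h * 4) ≡ 4 * r + 4 * (r * h)
  expand₁ = solve-∀
  expand₂ : ∀ q t → 4 * q + 4 * (q + t * q) ≡ (2 + t) * (q * 4)
  expand₂ = solve-∀
  -- With q = p + r, rounding down in h and in t costs at most 4q each. The total of 8q is exactly
  -- the 2 in (2 + t) * 4q.
  rm≤ : r * m ≤ (2 + t) * ((p + r) * K)
  rm≤ = begin
    r * m                                      ≤⟨ *-monoʳ-≤ r m≤ ⟩
    r * (4 + h * 4)                            ≡⟨ expand₁ r h ⟩
    4 * r + 4 * (r * h)                        ≤⟨ +-mono-≤ (*-monoʳ-≤ 4 (m≤n+m r p)) (*-monoʳ-≤ 4 rh≤) ⟩
    4 * (p + r) + 4 * ((p + r) + t * (p + r))  ≡⟨ expand₂ (p + r) t ⟩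
    (2 + t) * ((p + r) * 4)                    ≤⟨ *-monoʳ-≤ (2 + t) (*-monoʳ-≤ (p + r) 4≤K) ⟩
    (2 + t) * ((p + r) * K)                    ∎
  1≤t : 1 ≤ t
  -- The assumption that the desired length is at least 3 enters here: it forces 3 ≤ 2 + t.
  1≤t = ≤-pred (≤-pred (*-cancelʳ-≤ 3 (2 + t) ((p + r) * K) (≤-trans large rm≤)))

-- From the crux function to a long cycle

-- If the inequality failed, X would induce an α-crux with fewer than m vertices.
crux⇒sparse : ∀ {α G m p r b k} → α ≈ p /suc b → p + r ≡ suc b → n G ≡ suc k →
  (∀ H → IsCrux α G H → m ≤ n H) →
  ∀ {X} → Unique X → 1 ≤ length X → length X < m →
  (p + r) * (n G * arcs G X X) < p * (2 * edges G * length X)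
crux⇒sparse {α} {G} {m} {p} {r} {b} {k} α≈ q≡ N≡ minimal {X@(_ ∷ X′)} X! 1≤X X<m = ≰⇒> λ le →
  <⇒≱ X<m (minimal (induced G X) (induced-subgraph G X! , 1≤X ,
    ≤-≈⁺ (*-≈ {α} α≈ (avgDeg-≈ G N≡)) (avgDeg-≈ (induced G X) refl) (begin
      p * (2 * edges G) * length X        ≡⟨ *-assoc p (2 * edges G) (length X) ⟩
      p * (2 * edges G * length X)        ≤⟨ le ⟩
      (p + r) * (n G * arcs G X X)        ≡⟨ rotate (p + r) (n G) (arcs G X X) ⟩
      arcs G X X * ((p + r) * n G)        ≡⟨ cong₂ _*_ (≡.sym (2*edges-induced G X)) (cong₂ _*_ q≡ N≡) ⟩
      2 * edges (induced G X) * (suc b * suc k) ∎)))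
  where
  open ≤-Reasoning
  rotate : ∀ a b c → a * (b * c) ≡ c * (a * b)
  rotate = solve-∀

whole-dense : ∀ G → 2 * edges G * length (allFin (n G)) ≤ n G * arcs G (allFin (n G)) (allFin (n G))
whole-dense G = ≤-reflexive (trans (cong₂ _*_ (2*edges≡arcs G) (length-tabulate {n = n G} (λ i → i)))
  (*-comm (arcs G (allFin (n G)) (allFin (n G))) (n G)))

-- Deletion starts from the whole vertex set, whose average degree is exactly d(G). In the resulting
-- bound 2 + t, the denominator must be at least 4 because h is about m / 4.
long-cycle : ∀ K → 4 ≤ suc K → (α : ℚ) → 0ℚ ℚ.< α → α ℚ.< 1ℚ →
  (G : Graph) → 1 ≤ order G → (m : ℕ) → (∀ H → IsCrux α G H → m ≤ n H) →
  (+ 3 / 1) ℚ.≤ (1ℚ ℚ.- α) ℚ.* (+ m / suc K) →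
  Σ ℕ λ ℓ → Cycle G ℓ × ((1ℚ ℚ.- α) ℚ.* (+ m / suc K) ℚ.≤ + ℓ / 1)
long-cycle K 4≤K α 0<α α<1 G 1≤N m minimal large
  with p , r , b , α≈ , q≡ ← unit-interval-≈ α 0<α α<1
  with bound≈ ← *-≈ (1-≈ {α} {p} {r} α≈ q≡) (/-≈ m K)
  with h , t , 1≤h , 1≤t , 2h+t≤m , pt≤rh , rm≤ ←
         choose-h-t p r m (suc K) (subst (1 ≤_) (≡.sym q≡) (s≤s z≤n)) 4≤K
           (subst₂ (λ q x → 3 * (q * suc K) ≤ x) (≡.sym q≡) (*-identityʳ (r * m)) (≤-≈⁻ (/-≈ 3 0) bound≈ large))
  with ℓ , cycle , 2+t≤ℓ ←
         dense⇒LongCycle G {p = p} {r} {n G} {2 * edges G} 1≤h 1≤t 2h+t≤m pt≤rh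
           (crux⇒sparse {α} {G} α≈ q≡ (≡.sym (suc-pred (n G) {{>-nonZero 1≤N}})) minimal)
           (length (allFin (n G))) (allFin (n G)) ≤-refl (allFin⁺ (n G))
           (subst (1 ≤_) (≡.sym (length-tabulate {n = n G} (λ i → i))) 1≤N) (whole-dense G)
  = ℓ , cycle , ≤-≈⁺ bound≈ (/-≈ ℓ 0) (begin
      r * m * 1                   ≡⟨ *-identityʳ (r * m) ⟩
      r * m                       ≤⟨ rm≤ ⟩
      (2 + t) * ((p + r) * suc K) ≤⟨ *-monoˡ-≤ _ 2+t≤ℓ ⟩
      ℓ * ((p + r) * suc K)       ≡⟨ cong (λ q → ℓ * (q * suc K)) q≡ ⟩
      ℓ * (suc b * suc K)         ∎)
  where
  open ≤-Reasoning

theorem1p3 : (α : ℚ) → 0ℚ ℚ.< α → α ℚ.< 1ℚ →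
    (G : Graph) → 1 Data.Nat.≤ order G →
    (m : ℕ) → IsCruxNumber α G m →
    (+ 3 / 1) ℚ.≤ (1ℚ ℚ.- α) ℚ.* (+ m / 16000) →
    Σ ℕ λ ℓ → Cycle G ℓ × ((1ℚ ℚ.- α) ℚ.* (+ m / 16000) ℚ.≤ + ℓ / 1)
theorem1p3 α 0<α α<1 G 1≤N m (_ , minimal) large =
  -- The denominator is `suc K`, so 16000 corresponds to K = 15999.
  long-cycle 15999 (s≤s (s≤s (s≤s (s≤s z≤n)))) α 0<α α<1 G 1≤N m minimal large
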